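{- For every $n\ge 4$, the cycle graph $C_n$ satisfies $\operatorname{nim}(\mathrm{DNT}(C_n))=0$.
   Context: $C_n$ is the cycle graph with vertices $v_1,\dots,v_n$, where $v_i$ is adjacent to $v_{i+1}$ (indices modulo $n$). For a graph $G$ with vertex set $V$, a set $K\subseteq V$ is convex if it contains every vertex lying on any shortest path between two elements of $K$. The convex hull $[P]$ of $P\subseteq V$ is the smallest convex set containing $P$. The game $\mathrm{DNT}(G)$: positions are the sets $P\subseteq V$ with $[V\setminus P]=V$; the starting position is $\emptyset$; the options of $P$ are the sets $P\cup\{v\}$ with $v\in V\setminus P$ and $[V\setminus(P\cup\{v\})]=V$. The nim-value of a position is defined recursively by $\operatorname{nim}(p)=\operatorname{mex}\{\operatorname{nim}(q): q\text{ an option of }p\}$, where $\operatorname{mex}(A)$ is the smallest nonnegative integer not in $A$; the nim-value of a game is that of its starting position. -}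

module Defs where

open import Data.Fin.Base using (Fin; zero; suc; toℕ)
import Data.Fin.Properties as Fin
open import Data.Fin.Subset as Subset
  using (Subset; ⊤; ⊥; ∁; ⁅_⁆; _∪_; _⊆_; ∣_∣)
import Data.Fin.Subset.Properties as Subset
open import Data.List.Base as List
  using (List; []; _∷_; [_]; length; map; mapMaybe; allFin)
open import Data.Nat.ListAction using (sum)
open import Data.Maybe.Base as Maybe using (Maybe; just; nothing)
open import Axiom.UniquenessOfIdentityProofs using (module Decidable⇒UIP)
open import Data.List.Membership.Propositional using (_∈_; _∉_; mapWith∈)
open import Data.List.Membership.Propositional.Properties
  using (mapWith∈-cong; mapWith∈≗map; ∈-allFin; ∈-lookup)
open import Data.List.Membership.DecPropositional using (_∈?_)
open import Data.List.Relation.Unary.All as All using ()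
open import Data.List.Relation.Unary.AllPairs using ([]; _∷_)
open import Data.List.Relation.Unary.Any using (here; there)
open import Data.List.Relation.Unary.Unique.Propositional using (Unique)
import Data.List.Relation.Unary.Unique.DecPropositional as Unique
open import Data.Nat.Base
  using (ℕ; zero; suc; _+_; _≤_; _<_; z≤n; s≤s; >-nonZero)
open import Data.Nat.DivMod using (_%_; m<n⇒m%n≡m; n%n≡0)
open import Data.Nat.Induction using (<-wellFounded)
import Data.Nat.Properties as ℕ
open import Data.Product.Base using (∃; _×_; _,_; proj₁; proj₂)
open import Data.Sum.Base using (_⊎_; inj₁; inj₂; swap; [_,_]′)
open import Data.Vec.Base using (tabulate)
import Data.Vec.Properties as Vec
import Data.Bool.Properties as Bool
open import Function.Base using (_∘_)
open import Induction.WellFounded using (WellFounded; Acc; acc; module Subrelation)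
open import Level using (0ℓ)
open import Relation.Binary.Core using (Rel)
open import Relation.Binary.Definitions using (Symmetric; Irreflexive)
import Relation.Binary.Definitions as B
import Relation.Binary.Construct.On as On
open import Relation.Binary.PropositionalEquality
  using (_≡_; refl; sym; trans; cong; subst)
open import Relation.Nullary using (¬_; Dec; yes; no; does; contradiction)
open import Relation.Nullary.Decidable
  using (map′; _×-dec_; _⊎-dec_; ¬?; dec⇒maybe; decidable-stable; dec-true)
open import Relation.Unary using (Pred; Decidable)

private
  variable
    n : ℕ

private
  module _ {A B : Set} (f : A → Maybe B) where

    ∈-mapMaybe⁻ : ∀ {y} xs → y ∈ mapMaybe f xs → ∃ λ x → f x ≡ just y
    ∈-mapMaybe⁻ (x ∷ xs) y∈ with f x in eq
    ∈-mapMaybe⁻ (x ∷ xs) y∈          | nothing = ∈-mapMaybe⁻ xs y∈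
    ∈-mapMaybe⁻ (x ∷ xs) (here refl) | just _  = x , eq
    ∈-mapMaybe⁻ (x ∷ xs) (there y∈)  | just _  = ∈-mapMaybe⁻ xs y∈

    ∈-mapMaybe⁺ : ∀ {x y xs} → x ∈ xs → f x ≡ just y → y ∈ mapMaybe f xs
    ∈-mapMaybe⁺ {x} (here refl) eq with f x
    ∈-mapMaybe⁺ {x} (here refl) refl | just _ = here refl
    ∈-mapMaybe⁺ {xs = z ∷ _} (there x∈) eq with f z
    ... | nothing = ∈-mapMaybe⁺ x∈ eq
    ... | just _  = there (∈-mapMaybe⁺ x∈ eq)

private
  ∈⇒≤sum : ∀ {x} xs → x ∈ xs → x ≤ sum xs
  ∈⇒≤sum (x ∷ xs) (here refl) = ℕ.m≤m+n x (sum xs)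
  ∈⇒≤sum (x ∷ xs) (there i)   = ℕ.≤-trans (∈⇒≤sum xs i) (ℕ.m≤n+m (sum xs) x)

  search : ∀ xs k fuel → k + fuel ∉ xs → (∀ {j} → j < k → j ∈ xs) →
           ∃ λ m → m ∉ xs × (∀ {j} → j < m → j ∈ xs)
  search xs k fuel k+f∉ below with _∈?_ ℕ._≟_ k xs
  ... | no k∉ = k , k∉ , below
  search xs k zero k+0∉ below | yes k∈ =
    contradiction (subst (_∈ xs) (sym (ℕ.+-identityʳ k)) k∈) k+0∉
  search xs k (suc f) k+f∉ below | yes k∈ =
    search xs (suc k) f (k+f∉ ∘ subst (_∈ xs) (sym (ℕ.+-suc k f))) λ j<1+k →
      [ below , (λ { refl → k∈ }) ]′ (ℕ.m<1+n⇒m<n∨m≡n j<1+k)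

mex-exists : ∀ xs → ∃ λ m → m ∉ xs × (∀ {j} → j < m → j ∈ xs)
mex-exists xs = search xs 0 (suc (sum xs)) (ℕ.1+n≰n ∘ ∈⇒≤sum xs) λ ()

mex : List ℕ → ℕ
mex xs = proj₁ (mex-exists xs)

-- `options` is a list only in order that mex be computable; the order of
-- its elements and repetitions among them do not affect nim-values.

record Game : Set₁ where
  field
    Position : Set
    start    : Position
    options  : Position → List Position
    wf       : WellFounded (λ q p → q ∈ options p)

module _ (Γ : Game) where
  open Game Γ

  private
    nimAcc : ∀ p → Acc (λ q p → q ∈ options p) p → ℕ
    nimAcc p (acc rs) = mex (mapWith∈ (options p) λ {q} q∈ → nimAcc q (rs q∈))

    nimAcc-irrelevant : ∀ p a b → nimAcc p a ≡ nimAcc p b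
    nimAcc-irrelevant p (acc rs) (acc ss) = cong mex
      (mapWith∈-cong (options p) _ _ λ {q} q∈ → nimAcc-irrelevant q (rs q∈) (ss q∈))

  nimPosition : Position → ℕ
  nimPosition p = nimAcc p (wf p)

  nimPosition-unfold : ∀ p → nimPosition p ≡ mex (map nimPosition (options p))
  nimPosition-unfold p with wf p
  ... | acc rs = cong mex (trans
    (mapWith∈-cong (options p) _ _ λ {q} q∈ → nimAcc-irrelevant q (rs q∈) (wf q))
    (mapWith∈≗map nimPosition (options p)))

  nim : ℕ
  nim = nimPosition start

record Graph (n : ℕ) : Set₁ where
  infix 4 _~_ _~?_
  field
    _~_      : Rel (Fin n) 0ℓ
    _~?_     : B.Decidable _~_
    ~-sym    : Symmetric _~_
    ~-irrefl : Irreflexive _≡_ _~_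

-- The vertex vᵢ₊₁ is represented by i : Fin n.

cycle : ∀ n → 3 ≤ n → Graph n
cycle n 3≤n = record
  { _~_      = λ i j → next i j ⊎ next j i
  ; _~?_     = λ i j → (toℕ j ℕ.≟ _) ⊎-dec (toℕ i ℕ.≟ _)
  ; ~-sym    = swap
  ; ~-irrefl = λ { {i} refl → [ next-irrefl i , next-irrefl i ]′ }
  }
  where
  instance _ = >-nonZero (ℕ.≤-trans (s≤s z≤n) 3≤n)

  next : Rel (Fin n) 0ℓ
  next i j = toℕ j ≡ suc (toℕ i) % n

  next-irrefl : ∀ i → ¬ next i i
  next-irrefl i eq with ℕ.m≤n⇒m<n∨m≡n (Fin.toℕ<n i)
  ... | inj₁ 1+i<n = ℕ.1+n≢n (sym (trans eq (m<n⇒m%n≡m 1+i<n)))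
  ... | inj₂ 1+i≡n = contradiction 3≤n (ℕ.<⇒≱ (s≤s (ℕ.≤-trans (ℕ.≤-reflexive n≡1) (s≤s z≤n))))
    where
    i≡0 : toℕ i ≡ 0
    i≡0 = trans eq (trans (cong (_% n) 1+i≡n) (n%n≡0 n))
    n≡1 : n ≡ 1
    n≡1 = trans (sym 1+i≡n) (cong suc i≡0)

module _ (G : Graph n) where
  open Graph G

  -- Walks and paths are given by their list of vertices, endpoints included.

  data Walk : Fin n → Fin n → List (Fin n) → Set where
    stop : ∀ {u} → Walk u u [ u ]
    step : ∀ {u v w xs} → u ~ v → Walk v w xs → Walk u w (u ∷ xs)

  Path : Fin n → Fin n → List (Fin n) → Set
  Path u w xs = Walk u w xs × Unique xs

  -- Lists with fewer vertices are exactly the paths with fewer edges.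

  ShortestPath : Fin n → Fin n → List (Fin n) → Set
  ShortestPath u w xs = Path u w xs × (∀ {ys} → Path u w ys → length xs ≤ length ys)

  Convex : Subset n → Set
  Convex K = ∀ {u w xs v} → u Subset.∈ K → w Subset.∈ K →
             ShortestPath u w xs → v ∈ xs → v Subset.∈ K

  IsHull : Subset n → Subset n → Set
  IsHull P H = Convex H × P ⊆ H × (∀ K → Convex K → P ⊆ K → H ⊆ K)

  -- Decidability rests on the fact that a path has at most n vertices.

  private
    walk? : ∀ u w xs → Dec (Walk u w xs)
    walk? u w [] = no λ ()
    walk? u w (x ∷ []) = map′
      (λ { (refl , refl) → stop })
      (λ { stop → refl , refl ; (step _ ()) })
      (x Fin.≟ u ×-dec u Fin.≟ w)
    walk? u w (x ∷ y ∷ xs) = map′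
      (λ { (refl , u~y , p) → step u~y p })
      (λ { (step u~v stop) → refl , u~v , stop
         ; (step u~v p@(step _ _)) → refl , u~v , p })
      (x Fin.≟ u ×-dec u ~? y ×-dec walk? y w (y ∷ xs))

    path? : ∀ u w xs → Dec (Path u w xs)
    path? u w xs = walk? u w xs ×-dec Unique.unique? Fin._≟_ xs

    anyList? : ∀ {p} {Q : Pred (List (Fin n)) p} k → Decidable Q →
               Dec (∃ λ xs → length xs ≤ k × Q xs)
    anyList? zero Q? = map′ (λ q → [] , z≤n , q) (λ { ([] , _ , q) → q }) (Q? [])
    anyList? (suc k) Q? = map′
      (λ { (inj₁ q) → [] , z≤n , q
         ; (inj₂ (x , xs , l , q)) → x ∷ xs , s≤s l , q })
      (λ { ([] , _ , q) → inj₁ q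
         ; (x ∷ xs , s≤s l , q) → inj₂ (x , xs , l , q) })
      (Q? [] ⊎-dec Fin.any? λ x → anyList? k (Q? ∘ (x ∷_)))

    lookup-injective : ∀ {xs : List (Fin n)} → Unique xs →
                       ∀ {i j} → List.lookup xs i ≡ List.lookup xs j → i ≡ j
    lookup-injective (x∉ ∷ u) {zero}  {zero}  eq = refl
    lookup-injective (x∉ ∷ u) {zero}  {suc j} eq =
      contradiction eq (All.lookup x∉ (∈-lookup j))
    lookup-injective (x∉ ∷ u) {suc i} {zero}  eq =
      contradiction (sym eq) (All.lookup x∉ (∈-lookup i))
    lookup-injective (x∉ ∷ u) {suc i} {suc j} eq = cong suc (lookup-injective u eq)

    length≤n : ∀ {u w xs} → Path u w xs → length xs ≤ n
    length≤n (_ , u) = Fin.injective⇒≤ (lookup-injective u)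

    anyPath? : ∀ {p} {Q : Pred (List (Fin n)) p} u w → Decidable Q →
               Dec (∃ λ xs → Path u w xs × Q xs)
    anyPath? u w Q? = map′
      (λ (xs , _ , pq) → xs , pq)
      (λ (xs , p , q) → xs , length≤n p , p , q)
      (anyList? n λ xs → path? u w xs ×-dec Q? xs)

    shortestPath? : ∀ u w xs → Dec (ShortestPath u w xs)
    shortestPath? u w xs = path? u w xs ×-dec map′
      (λ ∄ {ys} p → ℕ.≮⇒≥ λ lt → ∄ (ys , p , lt))
      (λ min (ys , p , lt) → ℕ.<⇒≱ lt (min p))
      (¬? (anyPath? u w λ ys → length ys ℕ.<? length xs))

  convex? : Decidable Convex
  convex? K = map′
    (λ ∄ {u} {w} {xs} {v} u∈ w∈ sp v∈ → decidable-stable (v Subset.∈? K) λ v∉ →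
      ∄ (u , w , v , u∈ , w∈ , v∉ , xs , proj₁ sp , sp , v∈))
    (λ { c (u , w , v , u∈ , w∈ , v∉ , xs , _ , sp , v∈) → v∉ (c u∈ w∈ sp v∈) })
    (¬? (Fin.any? λ u → Fin.any? λ w → Fin.any? λ v →
      u Subset.∈? K ×-dec w Subset.∈? K ×-dec ¬? (v Subset.∈? K) ×-dec
      anyPath? u w λ xs → shortestPath? u w xs ×-dec _∈?_ Fin._≟_ v xs))

  private
    InHull : Subset n → Pred (Fin n) 0ℓ
    InHull P v = ∀ K → Convex K → P ⊆ K → v Subset.∈ K

    Separated : Subset n → Pred (Fin n) 0ℓ
    Separated P v = ∃ λ K → Convex K × P ⊆ K × v Subset.∉ K

    separated? : ∀ P → Decidable (Separated P)
    separated? P v = Subset.anySubset? λ K →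
      convex? K ×-dec P Subset.⊆? K ×-dec ¬? (v Subset.∈? K)

    inHull? : ∀ P → Decidable (InHull P)
    inHull? P v = map′ to from (¬? (separated? P v))
      where
      to : ¬ Separated P v → InHull P v
      to ¬s K c P⊆K = decidable-stable (v Subset.∈? K) λ v∉ → ¬s (K , c , P⊆K , v∉)
      from : InHull P v → ¬ Separated P v
      from h (K , c , P⊆K , v∉) = v∉ (h K c P⊆K)

    comprehension : ∀ {Q : Pred (Fin n) 0ℓ} → Decidable Q →
                    ∃ λ H → (∀ {v} → v Subset.∈ H → Q v) × (∀ {v} → Q v → v Subset.∈ H)
    comprehension Q? = tabulate f , to , from
      where
      f = λ v → does (Q? v)
      to : ∀ {v} → v Subset.∈ tabulate f → _
      to {v} v∈ with Q? v | trans (sym (Vec.lookup∘tabulate f v)) (Vec.[]=⇒lookup v∈)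
      ... | yes q | _ = q
      from : ∀ {v} → _ → v Subset.∈ tabulate f
      from {v} q = Vec.lookup⇒[]= v (tabulate f)
        (trans (Vec.lookup∘tabulate f v) (dec-true (Q? v) q))

  hull-exists : ∀ P → ∃ (IsHull P)
  hull-exists P with comprehension (inHull? P)
  ... | H , to , from = H
    , (λ u∈ w∈ sp v∈ → from λ K c P⊆K → c (to u∈ K c P⊆K) (to w∈ K c P⊆K) sp v∈)
    , (λ v∈P → from λ K c P⊆K → P⊆K v∈P)
    , (λ K c P⊆K v∈H → to v∈H K c P⊆K)

  hull : Subset n → Subset n
  hull P = proj₁ (hull-exists P)

  hull-isHull : ∀ P → IsHull P (hull P)
  hull-isHull P = proj₂ (hull-exists P)

  -- A subset P carries at most one proof of the equation, so positions are
  -- determined by their underlying sets.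

  DNTPosition : Set
  DNTPosition = ∃ λ P → hull (∁ P) ≡ ⊤

  IsOption : DNTPosition → DNTPosition → Set
  IsOption (Q , _) (P , _) = ∃ λ v → v Subset.∉ P × Q ≡ P ∪ ⁅ v ⁆

  private
    move? : ∀ P v → Dec (v Subset.∉ P × hull (∁ (P ∪ ⁅ v ⁆)) ≡ ⊤)
    move? P v = ¬? (v Subset.∈? P) ×-dec Vec.≡-dec Bool._≟_ _ _

    move : DNTPosition → Fin n → Maybe DNTPosition
    move (P , _) v = Maybe.map (λ (_ , eq) → P ∪ ⁅ v ⁆ , eq) (dec⇒maybe (move? P v))

    move-sound : ∀ p q v → move p v ≡ just q → IsOption q p
    move-sound (P , _) _ v eq with move? P v
    move-sound (P , _) _ v refl | yes (v∉P , _) = v , v∉P , refl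

    move-complete : ∀ p q ((v , _) : IsOption q p) → move p v ≡ just q
    move-complete (P , _) (_ , eq) (v , v∉P , refl) with move? P v
    ... | yes (_ , eq′) = cong (λ e → just (_ , e)) (Decidable⇒UIP.≡-irrelevant (Vec.≡-dec Bool._≟_) eq′ eq)
    ... | no ¬m = contradiction (v∉P , eq) ¬m

  DNTOptions : DNTPosition → List DNTPosition
  DNTOptions p = mapMaybe (move p) (allFin n)

  ∈-DNTOptions⁻ : ∀ {p q} → q ∈ DNTOptions p → IsOption q p
  ∈-DNTOptions⁻ {p} {q} q∈ with ∈-mapMaybe⁻ (move p) (allFin n) q∈
  ... | v , eq = move-sound p q v eq

  ∈-DNTOptions⁺ : ∀ {p q} → IsOption q p → q ∈ DNTOptions p
  ∈-DNTOptions⁺ {p} {q} o@(v , _) =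
    ∈-mapMaybe⁺ (move p) (∈-allFin v) (move-complete p q o)

  private
    unplayed : DNTPosition → ℕ
    unplayed (P , _) = ∣ ∁ P ∣

    unplayed-decreasing : ∀ {p q} → IsOption q p → unplayed q < unplayed p
    unplayed-decreasing {P , _} (v , v∉P , refl) = Subset.p⊂q⇒∣p∣<∣q∣ (Subset.p⊂q⇒∁p⊃∁q
      (Subset.p⊆p∪q ⁅ v ⁆ , v , Subset.q⊆p∪q P ⁅ v ⁆ (Subset.x∈⁅x⁆ v) , v∉P))

    DNT-start : hull (∁ ⊥) ≡ ⊤
    DNT-start = Subset.⊆-antisym Subset.⊆⊤ λ _ →
      proj₁ (proj₂ (hull-isHull (∁ ⊥))) (Subset.x∉p⇒x∈∁p Subset.∉⊥)

  DNT : Game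
  DNT = record
    { Position = DNTPosition
    ; start    = ⊥ , DNT-start
    ; options  = DNTOptions
    ; wf       = Subrelation.wellFounded
        (λ {q} {p} q∈ → unplayed-decreasing {p} {q} (∈-DNTOptions⁻ {p} {q} q∈))
        (On.wellFounded unplayed <-wellFounded)
    }

{-# OPTIONS --safe #-}
module Submission where

-- A convex set containing the ends of an arc with at most n/2 edges contains the arc, and an arc
-- with fewer than n/2 edges is convex. Call S ⊆ Cₙ generating if its hull is everything. In both
-- cases below the second player can always move, and so makes the last move.
--
-- n even: a pair of opposite vertices is generating, so the second player answers each deletion by
-- deleting the opposite vertex. Vertices remain, since a single vertex is not generating, and they
-- include an opposite pair.
--
-- n odd: by parity the second player always faces an even number of remaining vertices. Generating
-- sets have more than two elements, so there are at least four, a < b < c < d. One of the two arcs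
-- between a and c has at most n/2 edges, so b or d lies in the hull of the others and can be deleted.

open import Defs
open import Data.Nat.Base using (ℕ; _≤_)
open import Data.Nat.Properties using (<⇒≤)
open import Relation.Binary.PropositionalEquality using (_≡_)

open import Data.Nat.Properties hiding (<⇒≤)
open import Algebra.Properties.CommutativeSemigroup +-commutativeSemigroup
  using (x∙yz≈y∙xz; xy∙z≈y∙xz; xy∙z≈xz∙y)
open import Data.Empty using (⊥; ⊥-elim)
open import Data.Fin.Base using (Fin; zero; suc; toℕ)
import Data.Fin.Properties as Fin
open import Data.Fin.Properties using (toℕ<n; toℕ≤n; toℕ-injective; toℕ-fromℕ<)
open import Data.Fin.Subset as Subset using (Subset; inside; outside; ⊤; ∁; ⁅_⁆; _∪_; _⊆_; ∣_∣)
import Data.Fin.Subset.Properties as Subset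
open import Data.List.Base using (length; map; applyUpTo)
open import Data.List.Membership.Propositional using (_∈_; _∉_)
open import Data.List.Membership.Propositional.Properties using (∈-map⁺; ∈-map⁻; ∈-applyUpTo⁺)
open import Data.List.Properties using (length-applyUpTo)
open import Data.List.Relation.Unary.Any using (here; there)
open import Data.List.Relation.Unary.Unique.Propositional.Properties using (applyUpTo⁺₁)
open import Data.Nat.Base
  using (zero; suc; _+_; _*_; _∸_; _<_; NonZero; >-nonZero; ∣_-_∣; z≤n; s≤s; s≤s⁻¹)
open import Data.Nat.DivMod
open import Data.Nat.Solver using (module +-*-Solver)
open import Data.Product.Base using (∃; ∃₂; _×_; _,_; proj₁; proj₂)
open import Data.Sum.Base using (_⊎_; inj₁; inj₂; [_,_]′; swap)
open import Data.Vec.Base using (tabulate; []; _∷_; here; there)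
import Data.Vec.Properties as Vec
open import Function.Base using (_∘_; case_of_)
open import Induction.WellFounded using (Acc; acc)
open import Relation.Binary.PropositionalEquality
  using (_≢_; refl; sym; trans; cong; cong₂; subst; subst₂; module ≡-Reasoning)
open import Relation.Nullary using (¬_; does; yes; no; contradiction)
open import Relation.Nullary.Decidable using (dec-true)
open import Relation.Unary using (Decidable)

open +-*-Solver using (solve; _:+_; _:=_; con)

-- Distances between residues modulo n.

-- With δ = ∣ i - j ∣ for i, j < n: the residues i and j are at distance less than ℓ on the cycle ℤ/n.
Far : (n δ ℓ : ℕ) → Set
Far n δ ℓ = δ < ℓ ⊎ n < ℓ + δ

-- Serves a step that does not cross from n - 1 to 0: the direct and the wrapped distance each
-- change by at most one.
far-step : ∀ {n δ δ′ ℓ} → δ ≤ suc δ′ → δ′ ≤ suc δ → Far n δ ℓ → Far n δ′ (suc ℓ)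
far-step _ δ′≤ (inj₁ δ<ℓ) = inj₁ (≤-<-trans δ′≤ (s≤s δ<ℓ))
far-step {δ′ = δ′} {ℓ} δ≤ _ (inj₂ n<) =
  inj₂ (≤-trans n< (≤-trans (+-monoʳ-≤ ℓ δ≤) (≤-reflexive (+-suc ℓ δ′))))

-- Serves the step between n - 1 and 0: there the two differences to a third residue add up to n -
-- 1, so the direct and the wrapped distance trade places.
far-wrap : ∀ {n δ δ′ ℓ} → suc (δ + δ′) ≡ n → Far n δ ℓ → Far n δ′ (suc ℓ)
far-wrap {δ′ = δ′} refl (inj₁ δ<ℓ) = inj₂ (s≤s (+-monoˡ-≤ δ′ δ<ℓ))
far-wrap {δ = δ} {δ′} {ℓ} refl (inj₂ n<) = inj₁ (m≤n⇒m≤1+n (+-cancelʳ-≤ δ _ _ (begin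
  suc δ′ + δ          ≡⟨ cong suc (+-comm δ′ δ) ⟩
  suc (δ + δ′)        ≤⟨ n≤1+n _ ⟩
  suc (suc (δ + δ′))  ≤⟨ n< ⟩
  ℓ + δ               ∎)))
  where open ≤-Reasoning

refute : ∀ {l r} → l ≤ r → l ≡ suc r → ⊥
refute l≤r refl = 1+n≰n l≤r

-- Each case adds up hypotheses into some l ≤ r with l ≡ suc r.
no-detour : ∀ {n a b c ℓ ℓ′} → b ≤ a + c → c ≤ b + a → a < b + c → a + b + c < n + n → a + a < n →
            ℓ + ℓ′ ≤ 2 + a → Far n b ℓ → Far n c ℓ′ → ⊥
no-detour {n} {a} {b} {c} {ℓ} {ℓ′} b≤ c≤ a< per< 2a<n ℓ≤ (inj₁ p) (inj₁ q) =
  refute (+-mono-≤ (+-mono-≤ p q) (+-mono-≤ a< ℓ≤)) (solve 5 (λ a b c ℓ ℓ′ →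
    (con 1 :+ b :+ (con 1 :+ c)) :+ (con 1 :+ a :+ (ℓ :+ ℓ′)) :=
    con 1 :+ ((ℓ :+ ℓ′) :+ (b :+ c :+ (con 2 :+ a)))) refl a b c ℓ ℓ′)
no-detour {n} {a} {b} {c} {ℓ} {ℓ′} b≤ c≤ a< per< 2a<n ℓ≤ (inj₁ p) (inj₂ q) =
  refute (+-mono-≤ (+-mono-≤ p q) (+-mono-≤ (+-mono-≤ 2a<n c≤) ℓ≤)) (solve 6 (λ n a b c ℓ ℓ′ →
    (con 1 :+ b :+ (con 1 :+ n)) :+ ((con 1 :+ (a :+ a)) :+ c :+ (ℓ :+ ℓ′)) :=
    con 1 :+ ((ℓ :+ (ℓ′ :+ c)) :+ ((n :+ (b :+ a)) :+ (con 2 :+ a)))) refl n a b c ℓ ℓ′)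
no-detour {n} {a} {b} {c} {ℓ} {ℓ′} b≤ c≤ a< per< 2a<n ℓ≤ (inj₂ p) (inj₁ q) =
  refute (+-mono-≤ (+-mono-≤ p q) (+-mono-≤ (+-mono-≤ 2a<n b≤) ℓ≤)) (solve 6 (λ n a b c ℓ ℓ′ →
    (con 1 :+ n :+ (con 1 :+ c)) :+ ((con 1 :+ (a :+ a)) :+ b :+ (ℓ :+ ℓ′)) :=
    con 1 :+ (((ℓ :+ b) :+ ℓ′) :+ ((n :+ (a :+ c)) :+ (con 2 :+ a)))) refl n a b c ℓ ℓ′)
no-detour {n} {a} {b} {c} {ℓ} {ℓ′} b≤ c≤ a< per< 2a<n ℓ≤ (inj₂ p) (inj₂ q) =
  refute (+-mono-≤ (+-mono-≤ p q) (+-mono-≤ per< ℓ≤)) (solve 6 (λ n a b c ℓ ℓ′ →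
    (con 1 :+ n :+ (con 1 :+ n)) :+ ((con 1 :+ (a :+ b :+ c)) :+ (ℓ :+ ℓ′)) :=
    con 1 :+ (((ℓ :+ b) :+ (ℓ′ :+ c)) :+ ((n :+ n) :+ (con 2 :+ a)))) refl n a b c ℓ ℓ′)

∣1+m-n∣≤1+∣m-n∣ : ∀ i j → ∣ suc i - j ∣ ≤ suc ∣ i - j ∣
∣1+m-n∣≤1+∣m-n∣ i j = ≤-trans (∣-∣-triangle (suc i) i j)
  (+-monoˡ-≤ _ (≤-reflexive (trans (∣-∣-comm (suc i) i)
    (trans (cong (∣ i -_∣) (+-comm 1 i)) (∣m-m+n∣≡n i 1)))))

∣m-n∣≤1+∣1+m-n∣ : ∀ i j → ∣ i - j ∣ ≤ suc ∣ suc i - j ∣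
∣m-n∣≤1+∣1+m-n∣ i j = ≤-trans (∣-∣-triangle i (suc i) j)
  (+-monoˡ-≤ _ (≤-reflexive (trans (cong (∣ i -_∣) (+-comm 1 i)) (∣m-m+n∣≡n i 1))))

-- Since `m` is the largest of the three residues, the perimeter is twice `m ∸ i`, which is at most
-- twice `m`.
via-beyond : ∀ {n i j m} → i ≤ j → j < m → m < n →
             ∣ i - j ∣ < ∣ i - m ∣ + ∣ m - j ∣ × ∣ i - j ∣ + ∣ i - m ∣ + ∣ m - j ∣ < n + n
via-beyond {n} {i} {j} {m} i≤j j<m m<n
  rewrite m≤n⇒∣m-n∣≡n∸m i≤j | m≤n⇒∣m-n∣≡n∸m (≤-trans i≤j (<⇒≤ j<m)) | m≤n⇒∣n-m∣≡n∸m (<⇒≤ j<m) =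
  m≤n⇒m≤n+o (m ∸ j) (∸-monoˡ-< j<m i≤j) , (begin-strict
  j ∸ i + (m ∸ i) + (m ∸ j)   ≡⟨ xy∙z≈xz∙y (j ∸ i) (m ∸ i) (m ∸ j) ⟩
  j ∸ i + (m ∸ j) + (m ∸ i)   ≤⟨ +-mono-≤ (+-monoˡ-≤ (m ∸ j) (m∸n≤m j i)) (m∸n≤m m i) ⟩
  j + (m ∸ j) + m             ≡⟨ cong (_+ m) (m+[n∸m]≡n (<⇒≤ j<m)) ⟩
  m + m                       <⟨ +-mono-< m<n m<n ⟩
  n + n                       ∎)
  where open ≤-Reasoning

via-outside : ∀ {n d i j m} → i ≤ d → j ≤ d → d < m → m < n →
              ∣ i - j ∣ < ∣ i - m ∣ + ∣ m - j ∣ × ∣ i - j ∣ + ∣ i - m ∣ + ∣ m - j ∣ < n + n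
via-outside {n} {d} {i} {j} {m} i≤d j≤d d<m m<n with ≤-total i j
... | inj₁ i≤j = via-beyond i≤j (≤-<-trans j≤d d<m) m<n
... | inj₂ j≤i with via-beyond j≤i (≤-<-trans i≤d d<m) m<n
... | short , perimeter
  rewrite ∣-∣-comm j i | ∣-∣-comm m i | ∣-∣-comm j m =
  subst (∣ i - j ∣ <_) (+-comm ∣ m - j ∣ ∣ i - m ∣) short ,
  subst (_< n + n) (xy∙z≈xz∙y ∣ i - j ∣ ∣ m - j ∣ ∣ i - m ∣) perimeter

-- Second-player strategies and nim-value zero.

mex≡0 : ∀ {xs} → 0 ∉ xs → mex xs ≡ 0
mex≡0 {xs} 0∉ with mex-exists xs
... | zero  , _         = refl
... | suc _ , _ , below = contradiction (below (s≤s z≤n)) 0∉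

mex∉ : ∀ xs → mex xs ∉ xs
mex∉ xs = proj₁ (proj₂ (mex-exists xs))

module _ (Γ : Game) where
  open Game Γ

  -- `Z` is the invariant that the second player restores. By induction a reply inside `Z` has value
  -- 0, so the option it answers has a nonzero value, and the mex over all options is 0.
  nim≡0 : (Z : Position → Set) →
          (∀ {p q} → Z p → q ∈ options p → ∃ λ r → r ∈ options q × Z r) →
          ∀ {p} → Z p → nimPosition Γ p ≡ 0
  nim≡0 Z reply {p} = go p (wf p)
    where
    go : ∀ p → Acc (λ q p → q ∈ options p) p → Z p → nimPosition Γ p ≡ 0
    go p (acc rs) zp = trans (nimPosition-unfold Γ p) (mex≡0 (¬zero ∘ ∈-map⁻ (nimPosition Γ)))
      where
      ¬zero : ¬ ∃ λ q → q ∈ options p × 0 ≡ nimPosition Γ q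
      ¬zero (q , q∈ , 0≡) with rs q∈ | reply zp q∈
      ... | acc ss | r , r∈ , zr = mex∉ (map (nimPosition Γ) (options q)) (subst (_∈ _)
        (trans (go r (ss r∈) zr) (trans 0≡ (nimPosition-unfold Γ q)))
        (∈-map⁺ (nimPosition Γ) r∈))

-- Walks, hulls and DNT strategies in an arbitrary graph.

module _ {n} (G : Graph n) where
  open Graph G

  split-walk : ∀ {u w xs v} → Walk G u w xs → v ∈ xs →
               ∃₂ λ ys zs → Walk G u v ys × Walk G v w zs × length ys + length zs ≡ suc (length xs)
  split-walk stop       (here refl) = _ , _ , stop , stop , refl
  split-walk (step e p) (here refl) = _ , _ , stop , step e p , refl
  split-walk (step e p) (there v∈)  with split-walk p v∈
  ... | _ , _ , q , r , eq = _ , _ , step e q , r , cong suc eq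

  walk-along : (f : ℕ → Fin n) → ∀ d → (∀ {i} → i < d → f i ~ f (suc i)) →
               Walk G (f 0) (f d) (applyUpTo f (suc d))
  walk-along f zero    e = stop
  walk-along f (suc d) e = step (e (s≤s z≤n)) (walk-along (f ∘ suc) d (e ∘ s≤s))

  path-along : (f : ℕ → Fin n) → ∀ d → (∀ {i} → i < d → f i ~ f (suc i)) →
               (∀ {i j} → i < j → j ≤ d → f i ≢ f j) → Path G (f 0) (f d) (applyUpTo f (suc d))
  path-along f d e inj = walk-along f d e , applyUpTo⁺₁ f (suc d) λ i<j j<1+d → inj i<j (s≤s⁻¹ j<1+d)

  hull≡⊤⇒ : ∀ {S K v} → hull G S ≡ ⊤ → Convex G K → S ⊆ K → v Subset.∈ K
  hull≡⊤⇒ {S} eq convex S⊆K =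
    proj₂ (proj₂ (hull-isHull G S)) _ convex S⊆K (subst (_ Subset.∈_) (sym eq) Subset.∈⊤)

  ⇒hull≡⊤ : ∀ {S} → (∀ {K v} → Convex G K → S ⊆ K → v Subset.∈ K) → hull G S ≡ ⊤
  ⇒hull≡⊤ {S} h = Subset.⊆-antisym Subset.⊆⊤ λ _ →
    h (proj₁ (hull-isHull G S)) (proj₁ (proj₂ (hull-isHull G S)))

  -- The invariant depends only on the set of deleted vertices. `v` is the opponent's deletion and
  -- `w` the reply.
  nim-DNT≡0 : (Z : Subset n → Set) → Z Subset.⊥ →
    (∀ {P v} → Z P → v Subset.∉ P → hull G (∁ (P ∪ ⁅ v ⁆)) ≡ ⊤ →
      ∃ λ w → w Subset.∉ P ∪ ⁅ v ⁆ × hull G (∁ ((P ∪ ⁅ v ⁆) ∪ ⁅ w ⁆)) ≡ ⊤ × Z ((P ∪ ⁅ v ⁆) ∪ ⁅ w ⁆)) →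
    nim (DNT G) ≡ 0
  nim-DNT≡0 Z start reply = nim≡0 (DNT G) (Z ∘ proj₁)
    (λ {p} {q} zp q∈ → answer {p} {q} zp (∈-DNTOptions⁻ G {p} {q} q∈)) start
    where
    answer : ∀ {p q} → Z (proj₁ p) → IsOption G q p → ∃ λ r → r ∈ DNTOptions G q × Z (proj₁ r)
    answer {q = q@(_ , eq)} zp (v , v∉P , refl) =
      let w , w∉Q , eq′ , zr = reply zp v∉P eq
      in  (_ , eq′) , ∈-DNTOptions⁺ G {q} (w , w∉Q , refl) , zr

-- Finite subsets and their least elements.

comprehension : ∀ {n} {Q : Fin n → Set} → Decidable Q →
                ∃ λ K → (∀ {v} → v Subset.∈ K → Q v) × (∀ {v} → Q v → v Subset.∈ K)
comprehension {Q = Q} Q? = tabulate (does ∘ Q?) , to , from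
  where
  to : ∀ {v} → v Subset.∈ tabulate (does ∘ Q?) → Q v
  to {v} v∈ with Q? v | trans (sym (Vec.lookup∘tabulate (does ∘ Q?) v)) (Vec.[]=⇒lookup v∈)
  ... | yes q | _ = q
  from : ∀ {v} → Q v → v Subset.∈ tabulate (does ∘ Q?)
  from {v} q = Vec.lookup⇒[]= v _ (trans (Vec.lookup∘tabulate (does ∘ Q?) v) (dec-true (Q? v) q))

-- Repeated extraction from `rest` lists the elements of a subset in increasing order.
record Least {n} (p : Subset n) : Set where
  field
    least    : Fin n
    rest     : Subset n
    least∈   : least Subset.∈ p
    rest⊆    : rest ⊆ p
    cover    : ∀ {x} → x Subset.∈ p → x ≡ least ⊎ x Subset.∈ rest
    least<   : ∀ {x} → x Subset.∈ rest → toℕ least < toℕ x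
    size     : ∣ p ∣ ≡ suc ∣ rest ∣

least-of : ∀ {n} (p : Subset n) → 0 < ∣ p ∣ → Least p
least-of (outside ∷ p) 0< = record
  { least = suc least ; rest = outside ∷ rest ; least∈ = there least∈
  ; rest⊆ = λ { (there x∈) → there (rest⊆ x∈) }
  ; cover = λ { (there x∈) → [ (λ { refl → inj₁ refl }) , inj₂ ∘ there ]′ (cover x∈) }
  ; least< = λ { (there x∈) → s≤s (least< x∈) }
  ; size = size
  }
  where open Least (least-of p 0<)
least-of (inside ∷ p) 0< = record
  { least = zero ; rest = outside ∷ p ; least∈ = here
  ; rest⊆ = λ { (there x∈) → there x∈ }
  ; cover = λ { here → inj₁ refl ; (there x∈) → inj₂ (there x∈) }
  ; least< = λ { (there x∈) → s≤s z≤n }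
  ; size = refl
  }

∣∁p∣≡1+∣∁[p∪⁅x⁆]∣ : ∀ {n} {x : Fin n} {p} → x Subset.∉ p → ∣ ∁ p ∣ ≡ suc ∣ ∁ (p ∪ ⁅ x ⁆) ∣
∣∁p∣≡1+∣∁[p∪⁅x⁆]∣ {x = zero}  {inside  ∷ p} x∉ = contradiction here x∉
∣∁p∣≡1+∣∁[p∪⁅x⁆]∣ {x = zero}  {outside ∷ p} x∉ = cong (λ q → suc ∣ ∁ q ∣) (sym (Subset.∪-identityʳ p))
∣∁p∣≡1+∣∁[p∪⁅x⁆]∣ {x = suc x} {inside  ∷ p} x∉ = ∣∁p∣≡1+∣∁[p∪⁅x⁆]∣ (x∉ ∘ there)
∣∁p∣≡1+∣∁[p∪⁅x⁆]∣ {x = suc x} {outside ∷ p} x∉ = cong suc (∣∁p∣≡1+∣∁[p∪⁅x⁆]∣ (x∉ ∘ there))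

-- Rotations and coordinates modulo n.

module _ {n} .{{_ : NonZero n}} where

  [m%n+o]%n≡[m+o]%n : ∀ m o → (m % n + o) % n ≡ (m + o) % n
  [m%n+o]%n≡[m+o]%n m o = begin
    (m % n + o) % n           ≡⟨ %-distribˡ-+ (m % n) o n ⟩
    (m % n % n + o % n) % n   ≡⟨ cong (λ x → (x + o % n) % n) (m%n%n≡m%n m n) ⟩
    (m % n + o % n) % n       ≡⟨ %-distribˡ-+ m o n ⟨
    (m + o) % n               ∎
    where open ≡-Reasoning

  [o+m%n]%n≡[o+m]%n : ∀ o m → (o + m % n) % n ≡ (o + m) % n
  [o+m%n]%n≡[o+m]%n o m = begin
    (o + m % n) % n ≡⟨ cong (_% n) (+-comm o (m % n)) ⟩
    (m % n + o) % n ≡⟨ [m%n+o]%n≡[m+o]%n m o ⟩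
    (m + o) % n     ≡⟨ cong (_% n) (+-comm m o) ⟩
    (o + m) % n     ∎
    where open ≡-Reasoning

  shift : Fin n → ℕ → Fin n
  shift a i = (toℕ a + i) mod n

  -- Here `n ∸ toℕ a` plays the role of -a, so `coord a v` counts the steps from `a` forward to `v`
  -- and inverts `shift a` below `n`.
  coord : Fin n → Fin n → ℕ
  coord a v = (toℕ v + (n ∸ toℕ a)) % n

  toℕ-shift : ∀ a i → toℕ (shift a i) ≡ (toℕ a + i) % n
  toℕ-shift a i = toℕ-fromℕ< (m%n<n (toℕ a + i) n)

  coord<n : ∀ a v → coord a v < n
  coord<n a v = m%n<n (toℕ v + (n ∸ toℕ a)) n

  shift-≡ : ∀ a i {v} → toℕ a + i ≡ toℕ v → shift a i ≡ v
  shift-≡ a i {v} eq = toℕ-injective (begin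
    toℕ (shift a i) ≡⟨ toℕ-shift a i ⟩
    (toℕ a + i) % n ≡⟨ cong (_% n) eq ⟩
    toℕ v % n       ≡⟨ m<n⇒m%n≡m (toℕ<n v) ⟩
    toℕ v           ∎)
    where open ≡-Reasoning

  shift-≡+n : ∀ a i {v} → toℕ a + i ≡ toℕ v + n → shift a i ≡ v
  shift-≡+n a i {v} eq = toℕ-injective (begin
    toℕ (shift a i) ≡⟨ toℕ-shift a i ⟩
    (toℕ a + i) % n ≡⟨ cong (_% n) eq ⟩
    (toℕ v + n) % n ≡⟨ [m+n]%n≡m%n (toℕ v) n ⟩
    toℕ v % n       ≡⟨ m<n⇒m%n≡m (toℕ<n v) ⟩
    toℕ v           ∎)
    where open ≡-Reasoning

  shift-zero : ∀ a → shift a 0 ≡ a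
  shift-zero a = shift-≡ a 0 (+-identityʳ (toℕ a))

  shift-n : ∀ a → shift a n ≡ a
  shift-n a = shift-≡+n a n refl

  shift-shift : ∀ a i j → shift (shift a i) j ≡ shift a (i + j)
  shift-shift a i j = toℕ-injective (begin
    toℕ (shift (shift a i) j)   ≡⟨ toℕ-shift (shift a i) j ⟩
    (toℕ (shift a i) + j) % n   ≡⟨ cong (λ x → (x + j) % n) (toℕ-shift a i) ⟩
    ((toℕ a + i) % n + j) % n   ≡⟨ [m%n+o]%n≡[m+o]%n (toℕ a + i) j ⟩
    (toℕ a + i + j) % n         ≡⟨ cong (_% n) (+-assoc (toℕ a) i j) ⟩
    (toℕ a + (i + j)) % n       ≡⟨ toℕ-shift a (i + j) ⟨
    toℕ (shift a (i + j))       ∎)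
    where open ≡-Reasoning

  shift-coord : ∀ a v → shift a (coord a v) ≡ v
  shift-coord a v = toℕ-injective (begin
    toℕ (shift a (coord a v))             ≡⟨ toℕ-shift a (coord a v) ⟩
    (toℕ a + coord a v) % n               ≡⟨ [o+m%n]%n≡[o+m]%n (toℕ a) _ ⟩
    (toℕ a + (toℕ v + (n ∸ toℕ a))) % n   ≡⟨ cong (_% n) (x∙yz≈y∙xz (toℕ a) (toℕ v) _) ⟩
    (toℕ v + (toℕ a + (n ∸ toℕ a))) % n   ≡⟨ cong (λ x → (toℕ v + x) % n) (m+[n∸m]≡n (toℕ≤n a)) ⟩
    (toℕ v + n) % n                       ≡⟨ toℕ-shift v n ⟨
    toℕ (shift v n)                       ≡⟨ cong toℕ (shift-n v) ⟩
    toℕ v                                 ∎)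
    where open ≡-Reasoning

  coord-shift : ∀ a {i} → i < n → coord a (shift a i) ≡ i
  coord-shift a {i} i<n = begin
    (toℕ (shift a i) + (n ∸ toℕ a)) % n   ≡⟨ cong (λ x → (x + (n ∸ toℕ a)) % n) (toℕ-shift a i) ⟩
    ((toℕ a + i) % n + (n ∸ toℕ a)) % n   ≡⟨ [m%n+o]%n≡[m+o]%n (toℕ a + i) _ ⟩
    (toℕ a + i + (n ∸ toℕ a)) % n         ≡⟨ cong (_% n) (xy∙z≈y∙xz (toℕ a) i _) ⟩
    (i + (toℕ a + (n ∸ toℕ a))) % n       ≡⟨ cong (λ x → (i + x) % n) (m+[n∸m]≡n (toℕ≤n a)) ⟩
    (i + n) % n                           ≡⟨ [m+n]%n≡m%n i n ⟩
    i % n                                 ≡⟨ m<n⇒m%n≡m i<n ⟩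
    i                                     ∎
    where open ≡-Reasoning

  shift-injective : ∀ a {i j} → i < n → j < n → shift a i ≡ shift a j → i ≡ j
  shift-injective a i<n j<n eq =
    trans (sym (coord-shift a i<n)) (trans (cong (coord a) eq) (coord-shift a j<n))

  coord-self : ∀ a → coord a a ≡ 0
  coord-self a = trans (cong (coord a) (sym (shift-zero a))) (coord-shift a (≤-trans (s≤s z≤n) (toℕ<n a)))

  coord-next : ∀ a u v → toℕ v ≡ suc (toℕ u) % n → coord a v ≡ suc (coord a u) % n
  coord-next a u v eq = begin
    (toℕ v + (n ∸ toℕ a)) % n             ≡⟨ cong (λ x → (x + (n ∸ toℕ a)) % n) eq ⟩
    (suc (toℕ u) % n + (n ∸ toℕ a)) % n   ≡⟨ [m%n+o]%n≡[m+o]%n (suc (toℕ u)) _ ⟩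
    suc (toℕ u + (n ∸ toℕ a)) % n         ≡⟨ [o+m%n]%n≡[o+m]%n 1 (toℕ u + (n ∸ toℕ a)) ⟨
    suc (coord a u) % n                   ∎
    where open ≡-Reasoning

  -- Both directions are needed because an edge of a walk can be traversed either way round.
  far-next : ∀ {i i′ j ℓ} → i < n → j < n → i′ ≡ suc i % n →
             (Far n ∣ i′ - j ∣ ℓ → Far n ∣ i - j ∣ (suc ℓ)) ×
             (Far n ∣ i - j ∣ ℓ → Far n ∣ i′ - j ∣ (suc ℓ))
  far-next {i} {i′} {j} i<n j<n eq with m≤n⇒m<n∨m≡n i<n
  ... | inj₁ 1+i<n rewrite trans eq (m<n⇒m%n≡m 1+i<n) =
    far-step (∣1+m-n∣≤1+∣m-n∣ i j) (∣m-n∣≤1+∣1+m-n∣ i j) ,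
    far-step (∣m-n∣≤1+∣1+m-n∣ i j) (∣1+m-n∣≤1+∣m-n∣ i j)
  ... | inj₂ 1+i≡n rewrite trans eq (trans (cong (_% n) 1+i≡n) (n%n≡0 n)) =
    far-wrap around , far-wrap (trans (cong suc (+-comm ∣ i - j ∣ j)) around)
    where
    j≤i : j ≤ i
    j≤i = s≤s⁻¹ (subst (j <_) (sym 1+i≡n) j<n)
    around : suc (j + ∣ i - j ∣) ≡ n
    around = trans (cong suc (trans (cong (j +_) (m≤n⇒∣n-m∣≡n∸m j≤i)) (m+[n∸m]≡n j≤i))) 1+i≡n

-- Geodesics and convex arcs in the cycle.

module _ {n} (3≤n : 3 ≤ n) where

  private
    instance
      n≢0 : NonZero n
      n≢0 = >-nonZero (≤-trans (s≤s z≤n) 3≤n)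

    C : Graph n
    C = cycle n 3≤n

    -- Comparing nim (DNT C) with nim (DNT (cycle n 3≤n)) directly would unfold the recursion on Acc.
    unfold-C : nim (DNT C) ≡ 0 → nim (DNT (cycle n 3≤n)) ≡ 0
    unfold-C = subst (λ G → nim (DNT G) ≡ 0) {x = C} {y = cycle n 3≤n} refl

  open Graph C

  shift-edge : ∀ a i → shift a i ~ shift a (suc i)
  shift-edge a i = inj₁ (begin
    toℕ (shift a (suc i))       ≡⟨ toℕ-shift a (suc i) ⟩
    (toℕ a + suc i) % n         ≡⟨ cong (_% n) (+-suc (toℕ a) i) ⟩
    suc (toℕ a + i) % n         ≡⟨ [o+m%n]%n≡[o+m]%n {n} 1 (toℕ a + i) ⟨
    suc ((toℕ a + i) % n) % n   ≡⟨ cong (λ x → suc x % n) (toℕ-shift a i) ⟨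
    suc (toℕ (shift a i)) % n   ∎)
    where open ≡-Reasoning

  -- Each edge adds one vertex to the list and changes the cyclic distance by at most one.
  -- Coordinates may be taken from any base vertex `a`.
  walk-far : ∀ a {u w xs} → Walk C u w xs → Far n ∣ coord a u - coord a w ∣ (length xs)
  walk-far a {u} stop = inj₁ (s≤s (≤-reflexive (∣n-n∣≡0 (coord a u))))
  walk-far a {u} {w} (step {v = v} (inj₁ eq) p) =
    proj₁ (far-next (coord<n a u) (coord<n a w) (coord-next a u v eq)) (walk-far a p)
  walk-far a {u} {w} (step {v = v} (inj₂ eq) p) =
    proj₂ (far-next (coord<n a v) (coord<n a w) (coord-next a v u eq)) (walk-far a p)

  arc-path : ∀ a d → d < n → Path C a (shift a d) (applyUpTo (shift a) (suc d))
  arc-path a d d<n = subst (λ u → Path C u (shift a d) (applyUpTo (shift a) (suc d))) (shift-zero a)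
    (path-along C (shift a) d (λ {i} _ → shift-edge a i) λ i<j j≤d eq →
      <⇒≢ i<j (shift-injective a (<-≤-trans i<j (≤-trans j≤d (<⇒≤ d<n))) (≤-<-trans j≤d d<n) eq))

  half< : ∀ {d} → d + d ≤ n → d < n
  half< {zero}  _    = ≤-trans (s≤s z≤n) 3≤n
  half< {suc d} 2d≤n = ≤-trans (m<m+n (suc d) (s≤s z≤n)) 2d≤n

  -- As `d + d ≤ n`, going round the other way takes at least `d` edges too, so by `walk-far` every
  -- path has more than `d` vertices.
  arc-geodesic : ∀ a {d} → d + d ≤ n → ShortestPath C a (shift a d) (applyUpTo (shift a) (suc d))
  arc-geodesic a {d} 2d≤n = arc-path a d d<n , λ {ys} (p , _) →
    subst (_≤ length ys) (sym (length-applyUpTo (shift a) (suc d)))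
      (bound (subst (λ δ → Far n δ (length ys))
        (cong₂ ∣_-_∣ (coord-self a) (coord-shift a d<n)) (walk-far a p)))
    where
    d<n : d < n
    d<n = half< 2d≤n
    bound : ∀ {ℓ} → Far n d ℓ → suc d ≤ ℓ
    bound (inj₁ d<ℓ) = d<ℓ
    bound {ℓ} (inj₂ n<) = +-cancelʳ-≤ d _ _ (≤-trans (s≤s 2d≤n) n<)

  arc⊆ : ∀ {K a d i} → Convex C K → d + d ≤ n → a Subset.∈ K → shift a d Subset.∈ K →
         i ≤ d → shift a i Subset.∈ K
  arc⊆ {a = a} convex 2d≤n a∈ b∈ i≤d =
    convex a∈ b∈ (arc-geodesic a 2d≤n) (∈-applyUpTo⁺ (shift a) (s≤s i≤d))

  -- Provides an upper bound for the length of shortest paths between two vertices of an arc. When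
  -- `j ≤ i` the arc is run through backwards.
  arc-pair : ∀ a {d i j} → d < n → i ≤ d → j ≤ d →
             ∃ λ xs → Path C (shift a i) (shift a j) xs × length xs ≡ suc ∣ i - j ∣
  arc-pair a {d} {i} {j} d<n i≤d j≤d with ≤-total i j
  ... | inj₁ i≤j = _
    , subst (λ v → Path C (shift a i) v (applyUpTo (shift (shift a i)) (suc (j ∸ i))))
        (trans (shift-shift a i (j ∸ i)) (cong (shift a) (m+[n∸m]≡n i≤j)))
        (arc-path (shift a i) (j ∸ i) (≤-<-trans (m∸n≤m j i) (≤-<-trans j≤d d<n)))
    , trans (length-applyUpTo (shift (shift a i)) (suc (j ∸ i))) (cong suc (sym (m≤n⇒∣m-n∣≡n∸m i≤j)))
  ... | inj₂ j≤i = applyUpTo f (suc (i ∸ j))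
    , subst (λ v → Path C (shift a i) v (applyUpTo f (suc (i ∸ j)))) (cong (shift a) (m∸[m∸n]≡n j≤i))
        (path-along C f (i ∸ j) edge λ {s} {t} s<t t≤ eq → <⇒≢ s<t (∸-cancelˡ-≡
          (≤-trans (<⇒≤ s<t) (≤-trans t≤ (m∸n≤m i j))) (≤-trans t≤ (m∸n≤m i j))
          (shift-injective a (<n s) (<n t) eq)))
    , trans (length-applyUpTo f (suc (i ∸ j))) (cong suc (sym (m≤n⇒∣n-m∣≡n∸m j≤i)))
    where
    f : ℕ → Fin n
    f t = shift a (i ∸ t)
    <n : ∀ t → i ∸ t < n
    <n t = ≤-<-trans (m∸n≤m i t) (≤-<-trans i≤d d<n)
    edge : ∀ {t} → t < i ∸ j → f t ~ f (suc t)
    edge {t} t< = ~-sym {f (suc t)} {f t} (subst (λ x → f (suc t) ~ shift a x)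
      (sym (+-∸-assoc 1 (≤-trans t< (m∸n≤m i j)))) (shift-edge a (i ∸ suc t)))

  -- Suppose a shortest path between vertices of the arc leaves it at `v`. Each of its two halves is
  -- at least as long as the direct or the wrapped distance to `v`, and `no-detour` excludes all
  -- four combinations.
  arc-convex : ∀ {K : Subset n} {a d} → d + d < n → (∀ {v} → v Subset.∈ K → coord a v ≤ d) →
               (∀ {v} → coord a v ≤ d → v Subset.∈ K) → Convex C K
  arc-convex {K} {a} {d} 2d<n to from {x} {y} {xs} {v} x∈ y∈ ((p , _) , shortest) v∈
    with coord a v ≤? d
  ... | yes ≤d = from ≤d
  ... | no  ≰d = ⊥-elim (absurd (split-walk C p v∈))
    where
    i = coord a x
    j = coord a y
    m = coord a v
    bypass : ∣ i - j ∣ < ∣ i - m ∣ + ∣ m - j ∣ × ∣ i - j ∣ + ∣ i - m ∣ + ∣ m - j ∣ < n + n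
    bypass = via-outside (to x∈) (to y∈) (≰⇒> ≰d) (coord<n a v)
    ∣i-j∣≤d : ∣ i - j ∣ ≤ d
    ∣i-j∣≤d = ≤-trans (∣m-n∣≤m⊔n i j) (⊔-lub (to x∈) (to y∈))
    triangle₁ : ∣ i - m ∣ ≤ ∣ i - j ∣ + ∣ m - j ∣
    triangle₁ = ≤-trans (∣-∣-triangle i j m) (≤-reflexive (cong (∣ i - j ∣ +_) (∣-∣-comm j m)))
    triangle₂ : ∣ m - j ∣ ≤ ∣ i - m ∣ + ∣ i - j ∣
    triangle₂ = ≤-trans (∣-∣-triangle m i j) (≤-reflexive (cong (_+ ∣ i - j ∣) (∣-∣-comm m i)))
    d<n : d < n
    d<n = ≤-<-trans (m≤m+n d d) 2d<n
    length≤ : length xs ≤ suc ∣ i - j ∣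
    length≤ with arc-pair a d<n (to x∈) (to y∈)
    ... | zs , q , eq = subst (length xs ≤_) eq
      (shortest (subst₂ (λ u w → Path C u w zs) (shift-coord a x) (shift-coord a y) q))
    absurd : ¬ ∃₂ λ ys zs → Walk C x v ys × Walk C v y zs × length ys + length zs ≡ suc (length xs)
    -- The two halves both count `v`, so together they have at most 2 + `∣ i - j ∣` vertices.
    absurd (ys , zs , q , r , eq) = no-detour triangle₁ triangle₂ (proj₁ bypass) (proj₂ bypass)
      (≤-<-trans (+-mono-≤ ∣i-j∣≤d ∣i-j∣≤d) 2d<n)
      (≤-trans (≤-reflexive eq) (s≤s length≤)) (walk-far a q) (walk-far a r)

  1+half< : ∀ {d} → d + d < n → suc d < n
  1+half< {zero}  _    = ≤-trans (s≤s (s≤s z≤n)) 3≤n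
  1+half< {suc d} 2d<n = ≤-<-trans (s≤s (m≤n+m (suc d) d)) 2d<n

  hull-in-arc≢⊤ : ∀ {S : Subset n} {a : Fin n} {d} → d + d < n →
                  (∀ {v} → v Subset.∈ S → coord a v ≤ d) → hull C S ≢ ⊤
  -- The arc is convex, yet misses the vertex at offset `suc d`, just past its end.
  hull-in-arc≢⊤ {a = a} {d} 2d<n S⊆arc eq with comprehension (λ v → coord a v ≤? d)
  ... | K , to , from = 1+n≰n (subst (_≤ d) (coord-shift a (1+half< 2d<n))
    (to (hull≡⊤⇒ C eq (arc-convex {a = a} 2d<n to from) (from ∘ S⊆arc))))

  -- Even n: the mirror strategy.

  module Even {k} (k+k≡n : k + k ≡ n) where

    opposite : Fin n → Fin n
    opposite v = shift v k

    opposite-involutive : ∀ v → opposite (opposite v) ≡ v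
    opposite-involutive v = trans (shift-shift v k k) (trans (cong (shift v) k+k≡n) (shift-n v))

    opposite≢ : ∀ v → opposite v ≢ v
    opposite≢ v eq = contradiction k+k≡n (subst (λ k → k + k ≢ n) (sym k≡0) (<⇒≢ 0<n))
      where
      0<n : 0 < n
      0<n = ≤-trans (s≤s z≤n) 3≤n
      k≡0 : k ≡ 0
      k≡0 = shift-injective v (half< (≤-reflexive k+k≡n)) 0<n (trans eq (sym (shift-zero v)))

    -- Both arcs between `u` and its opposite have exactly n/2 edges, so both are geodesic, and
    -- together they cover the cycle.
    opposite-pair : ∀ {K u} → Convex C K → u Subset.∈ K → opposite u Subset.∈ K → ∀ {v} → v Subset.∈ K
    opposite-pair {K} {u} convex u∈ u′∈ {v} with ≤-total (coord u v) k
    ... | inj₁ ≤k = subst (Subset._∈ K) (shift-coord u v) (arc⊆ convex (≤-reflexive k+k≡n) u∈ u′∈ ≤k)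
    ... | inj₂ k≤ = subst (Subset._∈ K)
      (trans (shift-shift u k (coord u v ∸ k)) (trans (cong (shift u) (m+[n∸m]≡n k≤)) (shift-coord u v)))
      (arc⊆ convex (≤-reflexive k+k≡n) u′∈ (subst (Subset._∈ K) (sym (opposite-involutive u)) u∈)
        (m≤n+o⇒m∸n≤o _ k (≤-trans (<⇒≤ (coord<n u v)) (≤-reflexive (sym k+k≡n)))))

    Symmetric : Subset n → Set
    Symmetric P = ∀ {v} → v Subset.∉ P → opposite v Subset.∉ P

    mirror : ∀ {P v} → Symmetric P → v Subset.∉ P → hull C (∁ (P ∪ ⁅ v ⁆)) ≡ ⊤ →
             ∃ λ w → w Subset.∉ P ∪ ⁅ v ⁆ × hull C (∁ ((P ∪ ⁅ v ⁆) ∪ ⁅ w ⁆)) ≡ ⊤ ×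
                   Symmetric ((P ∪ ⁅ v ⁆) ∪ ⁅ w ⁆)
    mirror {P} {v} symm v∉P eq = w , w∉Q , hull≡⊤ , R-symm
      where
      w = opposite v
      Q = P ∪ ⁅ v ⁆
      R = Q ∪ ⁅ w ⁆

      w∉Q : w Subset.∉ Q
      w∉Q w∈Q = [ symm v∉P , opposite≢ v ∘ Subset.x∈⁅y⁆⇒x≡y v ]′ (Subset.x∈p∪q⁻ P ⁅ v ⁆ w∈Q)

      R-symm : Symmetric R
      -- If the opposite of `u` was deleted, then `u` was deleted as well: as the partner of `v` or
      -- `w`, or by the symmetry of `P`.
      R-symm {u} u∉R u′∈R with Subset.x∈p∪q⁻ Q ⁅ w ⁆ u′∈R
      ... | inj₂ u′∈w = u∉R (Subset.x∈p∪q⁺ (inj₁ (Subset.x∈p∪q⁺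
        (inj₂ (subst (Subset._∈ ⁅ v ⁆) v≡u (Subset.x∈⁅x⁆ v))))))
        where
        v≡u : v ≡ u
        v≡u = trans (sym (opposite-involutive v))
          (trans (cong opposite (sym (Subset.x∈⁅y⁆⇒x≡y w u′∈w))) (opposite-involutive u))
      ... | inj₁ u′∈Q with Subset.x∈p∪q⁻ P ⁅ v ⁆ u′∈Q
      ... | inj₁ u′∈P = symm (λ u∈P → u∉R (Subset.x∈p∪q⁺ (inj₁ (Subset.x∈p∪q⁺ (inj₁ u∈P))))) u′∈P
      ... | inj₂ u′∈v = u∉R (Subset.x∈p∪q⁺ (inj₂ (subst (Subset._∈ ⁅ w ⁆) w≡u (Subset.x∈⁅x⁆ w))))
        where
        w≡u : w ≡ u
        w≡u = trans (cong opposite (sym (Subset.x∈⁅y⁆⇒x≡y v u′∈v))) (opposite-involutive u)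

      -- If the reply left nothing, then `w` alone remained before it. A single vertex is an arc
      -- with no edges, so the opponent's move would have been illegal.
      only-w : Subset.Empty (∁ R) → ∀ {u} → u Subset.∈ ∁ Q → coord w u ≤ 0
      only-w empty {u} u∈ = case u Fin.≟ w of λ
        { (yes refl) → ≤-reflexive (coord-self w)
        ; (no  u≢w)  → contradiction (u , Subset.x∉p⇒x∈∁p
            ([ Subset.x∈∁p⇒x∉p u∈ , u≢w ∘ Subset.x∈⁅y⁆⇒x≡y w ]′ ∘ Subset.x∈p∪q⁻ Q ⁅ w ⁆)) empty
        }

      hull≡⊤ : hull C (∁ R) ≡ ⊤
      hull≡⊤ = case Subset.nonempty? (∁ R) of λ
        { (yes (u , u∈)) → ⇒hull≡⊤ C λ convex ∁R⊆ →
            opposite-pair convex (∁R⊆ u∈) (∁R⊆ (Subset.x∉p⇒x∈∁p (R-symm (Subset.x∈∁p⇒x∉p u∈))))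
        ; (no empty) → contradiction eq
            (hull-in-arc≢⊤ {a = w} {d = 0} (≤-trans (s≤s z≤n) 3≤n) (only-w empty))
        }

    nim≡0-even : nim (DNT (cycle n 3≤n)) ≡ 0
    nim≡0-even = unfold-C (nim-DNT≡0 C Symmetric (λ _ → Subset.∉⊥) mirror)

  -- Complementary arcs and redundant vertices.

  module _ {a b : Fin n} (a<b : toℕ a < toℕ b) where

    shift-up : shift a (toℕ b ∸ toℕ a) ≡ b
    shift-up = shift-≡ {n} a _ (m+[n∸m]≡n (<⇒≤ a<b))

    shift-around : shift b (n ∸ (toℕ b ∸ toℕ a)) ≡ a
    shift-around = shift-≡+n {n} b _ (begin
      toℕ b + (n ∸ e)         ≡⟨ cong (_+ (n ∸ e)) (m+[n∸m]≡n (<⇒≤ a<b)) ⟨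
      toℕ a + e + (n ∸ e)     ≡⟨ +-assoc (toℕ a) e (n ∸ e) ⟩
      toℕ a + (e + (n ∸ e))   ≡⟨ cong (toℕ a +_) (m+[n∸m]≡n (≤-trans (m∸n≤m (toℕ b) (toℕ a)) (toℕ≤n b))) ⟩
      toℕ a + n               ∎)
      where
      open ≡-Reasoning
      e = toℕ b ∸ toℕ a

    -- The two arcs between `a` and `b` have `e` and `n ∸ e` edges, and the smaller number is at
    -- most n/2.
    half-turn : let e = toℕ b ∸ toℕ a in e + e ≤ n ⊎ (n ∸ e) + (n ∸ e) ≤ n
    half-turn with ≤-total e (n ∸ e)
      where e = toℕ b ∸ toℕ a
    ... | inj₁ e≤f = inj₁ (≤-trans (+-monoʳ-≤ _ e≤f) (≤-reflexive (m+[n∸m]≡n e≤n)))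
      where e≤n = ≤-trans (m∸n≤m (toℕ b) (toℕ a)) (toℕ≤n b)
    ... | inj₂ f≤e = inj₂ (≤-trans (+-monoˡ-≤ _ f≤e) (≤-reflexive (m+[n∸m]≡n e≤n)))
      where e≤n = ≤-trans (m∸n≤m (toℕ b) (toℕ a)) (toℕ≤n b)

  -- This is membership of `w` in the hull of S without `w`, phrased through convex sets so that no
  -- smaller subset has to be formed.
  Redundant : Subset n → Fin n → Set
  Redundant S w = ∀ {K} → Convex C K → (∀ {x} → x Subset.∈ S → x ≢ w → x Subset.∈ K) → w Subset.∈ K

  redundant : ∀ {S : Subset n} → 4 ≤ ∣ S ∣ → ∃ λ w → w Subset.∈ S × Redundant S w
  redundant {S} 4≤ = choose (half-turn a<c)
    where
    La = least-of S (≤-trans (s≤s z≤n) 4≤)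
    module A = Least La
    3≤ : 3 ≤ ∣ A.rest ∣
    3≤ = s≤s⁻¹ (≤-trans 4≤ (≤-reflexive A.size))
    Lb = least-of A.rest (≤-trans (s≤s z≤n) 3≤)
    module B = Least Lb
    2≤ : 2 ≤ ∣ B.rest ∣
    2≤ = s≤s⁻¹ (≤-trans 3≤ (≤-reflexive B.size))
    Lc = least-of B.rest (≤-trans (s≤s z≤n) 2≤)
    module C′ = Least Lc
    1≤ : 1 ≤ ∣ C′.rest ∣
    1≤ = s≤s⁻¹ (≤-trans 2≤ (≤-reflexive C′.size))
    module D = Least (least-of C′.rest 1≤)
    a = A.least
    b = B.least
    c = C′.least
    d = D.least
    a<b = A.least< B.least∈
    b<c = B.least< C′.least∈
    c<d = C′.least< D.least∈
    a<c = <-trans a<b b<c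
    e = toℕ c ∸ toℕ a
    c∈ : c Subset.∈ S
    c∈ = A.rest⊆ (B.rest⊆ C′.least∈)

    <⇒≢ᶠ : ∀ {x y : Fin n} → toℕ x < toℕ y → x ≢ y
    <⇒≢ᶠ x<y refl = <-irrefl refl x<y

    choose : e + e ≤ n ⊎ (n ∸ e) + (n ∸ e) ≤ n → ∃ λ w → w Subset.∈ S × Redundant S w
    -- The arc from `a` up to `c` is short and passes through `b`.
    choose (inj₁ 2e≤n) = b , A.rest⊆ B.least∈ , λ {K} convex others →
      subst (Subset._∈ K) (shift-up a<b) (arc⊆ convex 2e≤n
        (others A.least∈ (<⇒≢ᶠ a<b))
        (subst (Subset._∈ K) (sym (shift-up a<c)) (others c∈ (<⇒≢ᶠ b<c ∘ sym)))
        (∸-monoˡ-≤ (toℕ a) (<⇒≤ b<c)))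
    -- The arc from `c` through 0 to `a` is short. It reaches `d` first, because the offset of `d`
    -- from `c` plus `e` is at most `n`.
    choose (inj₂ 2f≤n) = d , A.rest⊆ (B.rest⊆ (C′.rest⊆ D.least∈)) , λ {K} convex others →
      subst (Subset._∈ K) (shift-up c<d) (arc⊆ convex 2f≤n
        (others c∈ (<⇒≢ᶠ c<d))
        (subst (Subset._∈ K) (sym (shift-around a<c)) (others A.least∈ (<⇒≢ᶠ (<-trans a<c c<d))))
        (m+n≤o⇒m≤o∸n _ (begin
          toℕ d ∸ toℕ c + (toℕ c ∸ toℕ a)   ≤⟨ +-monoʳ-≤ _ (m∸n≤m (toℕ c) (toℕ a)) ⟩
          toℕ d ∸ toℕ c + toℕ c             ≡⟨ m∸n+n≡m (<⇒≤ c<d) ⟩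
          toℕ d                             ≤⟨ toℕ≤n d ⟩
          n                                 ∎)))
      where open ≤-Reasoning

  -- Odd n: the parity strategy.

  module Odd (odd : ∀ {h} → h + h ≢ n) where

    ∣S∣≡0⇒hull≢⊤ : ∀ {S : Subset n} → ∣ S ∣ ≡ 0 → hull C S ≢ ⊤
    ∣S∣≡0⇒hull≢⊤ ∣S∣≡0 = hull-in-arc≢⊤ {a = 0 mod n} {d = 0} (≤-trans (s≤s z≤n) 3≤n) λ v∈ →
      contradiction (≤-trans (≤-<-trans z≤n (Subset.x∈p⇒∣p-x∣<∣p∣ v∈)) (≤-reflexive ∣S∣≡0)) λ ()

    -- For odd `n` the bound `d + d ≤ n` is strict, so the arc joining the two vertices is convex
    -- and proper.
    hull-pair≢⊤ : ∀ {S : Subset n} {a b : Fin n} {d} → d + d ≤ n → shift a d ≡ b →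
                  (∀ {v} → v Subset.∈ S → v ≡ a ⊎ v ≡ b) → hull C S ≢ ⊤
    hull-pair≢⊤ {a = a} {d = d} 2d≤n refl S⊆ = hull-in-arc≢⊤ {a = a} (≤∧≢⇒< 2d≤n (odd {d})) λ v∈ →
      [ (λ { refl → ≤-trans (≤-reflexive (coord-self a)) z≤n })
      , (λ { refl → ≤-reflexive (coord-shift a (half< 2d≤n)) }) ]′ (S⊆ v∈)

    ∣S∣≡2⇒hull≢⊤ : ∀ {S : Subset n} → ∣ S ∣ ≡ 2 → hull C S ≢ ⊤
    ∣S∣≡2⇒hull≢⊤ {S} ∣S∣≡2 = choose (half-turn a<b)
      where
      La = least-of S (≤-trans (s≤s z≤n) (≤-reflexive (sym ∣S∣≡2)))
      module A = Least La
      ∣rest∣≡1 : ∣ A.rest ∣ ≡ 1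
      ∣rest∣≡1 = suc-injective (trans (sym A.size) ∣S∣≡2)
      Lb = least-of A.rest (≤-reflexive (sym ∣rest∣≡1))
      module B = Least Lb
      a = A.least
      b = B.least
      a<b = A.least< B.least∈
      e = toℕ b ∸ toℕ a
      pair : ∀ {v} → v Subset.∈ S → v ≡ a ⊎ v ≡ b
      pair v∈ with A.cover v∈
      ... | inj₁ v≡a = inj₁ v≡a
      ... | inj₂ v∈′ with B.cover v∈′
      ... | inj₁ v≡b = inj₂ v≡b
      ... | inj₂ v∈″ = contradiction (≤-trans (≤-<-trans z≤n (Subset.x∈p⇒∣p-x∣<∣p∣ v∈″))
        (≤-reflexive (suc-injective (trans (sym B.size) ∣rest∣≡1)))) λ ()
      choose : e + e ≤ n ⊎ (n ∸ e) + (n ∸ e) ≤ n → hull C S ≢ ⊤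
      choose (inj₁ 2e≤n) = hull-pair≢⊤ 2e≤n (shift-up a<b) pair
      -- The short arc now starts at `b`, hence the exchanged roles.
      choose (inj₂ 2f≤n) = hull-pair≢⊤ 2f≤n (shift-around a<b) (swap ∘ pair)

    -- The only smaller even sizes are 0 and 2, and neither is generating.
    even-hull⇒4≤ : ∀ {S : Subset n} m → ∣ S ∣ ≡ m + m → hull C S ≡ ⊤ → 4 ≤ ∣ S ∣
    even-hull⇒4≤ 0 eq gen = contradiction gen (∣S∣≡0⇒hull≢⊤ eq)
    even-hull⇒4≤ 1 eq gen = contradiction gen (∣S∣≡2⇒hull≢⊤ eq)
    even-hull⇒4≤ (suc (suc m)) eq gen = ≤-trans
      (+-mono-≤ {2} {2 + m} {2} (s≤s (s≤s z≤n)) (s≤s (s≤s z≤n))) (≤-reflexive (sym eq))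

    -- The invariant when the opponent is to move, so that the second player faces an even number of
    -- vertices.
    OddLeft : Subset n → Set
    OddLeft P = ∃ λ m → ∣ ∁ P ∣ ≡ suc (m + m)

    reply : ∀ {P v} → OddLeft P → v Subset.∉ P → hull C (∁ (P ∪ ⁅ v ⁆)) ≡ ⊤ →
            ∃ λ w → w Subset.∉ P ∪ ⁅ v ⁆ × hull C (∁ ((P ∪ ⁅ v ⁆) ∪ ⁅ w ⁆)) ≡ ⊤ ×
                  OddLeft ((P ∪ ⁅ v ⁆) ∪ ⁅ w ⁆)
    reply {P} {v} (m , eq) v∉P gen = answer m ∣∁Q∣≡2m (redundant (even-hull⇒4≤ m ∣∁Q∣≡2m gen))
      where
      Q = P ∪ ⁅ v ⁆
      ∣∁Q∣≡2m : ∣ ∁ Q ∣ ≡ m + m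
      ∣∁Q∣≡2m = suc-injective (trans (sym (∣∁p∣≡1+∣∁[p∪⁅x⁆]∣ v∉P)) eq)

      answer : ∀ m → ∣ ∁ Q ∣ ≡ m + m → (∃ λ w → w Subset.∈ ∁ Q × Redundant (∁ Q) w) →
        ∃ λ w → w Subset.∉ Q × hull C (∁ (Q ∪ ⁅ w ⁆)) ≡ ⊤ × OddLeft (Q ∪ ⁅ w ⁆)
      answer zero eq _ = contradiction gen (∣S∣≡0⇒hull≢⊤ eq)
      answer (suc m) eq (w , w∈∁Q , redundant-w) = w , w∉Q , ⇒hull≡⊤ C hull≡⊤ , m , suc-injective
        (trans (sym (∣∁p∣≡1+∣∁[p∪⁅x⁆]∣ w∉Q)) (trans eq (cong suc (+-suc m m))))
        where
        w∉Q : w Subset.∉ Q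
        w∉Q = Subset.x∈∁p⇒x∉p w∈∁Q
        -- A convex set containing what is left after the reply also contains the redundant `w`,
        -- hence all of `∁ Q`, which is generating.
        hull≡⊤ : ∀ {K u} → Convex C K → ∁ (Q ∪ ⁅ w ⁆) ⊆ K → u Subset.∈ K
        hull≡⊤ {K} convex ∁R⊆K = hull≡⊤⇒ C gen convex ∁Q⊆K
          where
          others : ∀ {x} → x Subset.∈ ∁ Q → x ≢ w → x Subset.∈ K
          others x∈ x≢w = ∁R⊆K (Subset.x∉p⇒x∈∁p
            ([ Subset.x∈∁p⇒x∉p x∈ , x≢w ∘ Subset.x∈⁅y⁆⇒x≡y w ]′ ∘ Subset.x∈p∪q⁻ Q ⁅ w ⁆))
          ∁Q⊆K : ∁ Q ⊆ K
          ∁Q⊆K {x} x∈ = case x Fin.≟ w of λ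
            { (yes refl) → redundant-w convex others
            ; (no  x≢w)  → others x∈ x≢w
            }

    nim≡0-odd : ∀ {h} → suc (h + h) ≡ n → nim (DNT (cycle n 3≤n)) ≡ 0
    nim≡0-odd {h} eq = unfold-C (nim-DNT≡0 C OddLeft (h , trans ∣∁⊥∣≡n (sym eq)) reply)
      where
      ∣∁⊥∣≡n : ∣ ∁ (Subset.⊥ {n}) ∣ ≡ n
      ∣∁⊥∣≡n = trans (Subset.∣∁p∣≡n∸∣p∣ (Subset.⊥ {n})) (cong (n ∸_) (Subset.∣⊥∣≡0 n))

-- The two parities combined.

halve : ∀ n → ∃ λ h → h + h ≡ n ⊎ suc (h + h) ≡ n
halve zero    = 0 , inj₁ refl
halve (suc n) with halve n
... | h , inj₁ refl = h , inj₂ refl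
... | h , inj₂ refl = suc h , inj₁ (cong suc (+-suc h h))

2*m≡m+m : ∀ m → 2 * m ≡ m + m
2*m≡m+m m = cong (m +_) (+-identityʳ m)

proposition5p3 : (n : ℕ) (4≤n : 4 ≤ n) → nim (DNT (cycle n (<⇒≤ 4≤n))) ≡ 0
proposition5p3 n 4≤n = by-parity (halve n)
  where
  open ≡-Reasoning
  by-parity : (∃ λ h → h + h ≡ n ⊎ suc (h + h) ≡ n) → nim (DNT (cycle n (<⇒≤ 4≤n))) ≡ 0
  by-parity (h , inj₁ even) = Even.nim≡0-even {n} (<⇒≤ 4≤n) {h} even
  by-parity (h , inj₂ odd)  = Odd.nim≡0-odd {n} (<⇒≤ 4≤n) (λ {k} k+k≡n → even≢odd k h (begin
    2 * k         ≡⟨ 2*m≡m+m k ⟩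
    k + k         ≡⟨ trans k+k≡n (sym odd) ⟩
    suc (h + h)   ≡⟨ cong suc (2*m≡m+m h) ⟨
    suc (2 * h)   ∎)) {h} odd
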